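{- Let $q$ be a prime power and let $n$ be an integer with $2\leqslant n\leqslant q+2$. Then the entries $m_{a,b}$ of the matrix $M(0,n,q)$ satisfy: (1) $m_{a,1}=1$ for $1\leqslant a\leqslant n$; (2) $m_{a,b}=0$ for $1\leqslant a\leqslant n-2$, $2\leqslant b\leqslant \lceil n/2\rceil$ (that is, $b\leqslant \frac n2$ if $n$ is even and $b\leqslant\frac{n+1}{2}$ if $n$ is odd) and $b<n+1-a$. That is, $M(0,n,q)$ is the matrix whose first column is $(1,1,\dots,1,1)^{T}$, whose last column is $(0,-1,\dots,-1,0)^{T}$ (entries $m_{1,n}=m_{n,n}=0$ and $m_{a,n}=-1$ for $2\leqslant a\leqslant n-1$), and in which, for $2\leqslant b\leqslant n-1$, $m_{a,b}=1$ if $a+b=n+1$ and $m_{a,b}=0$ otherwise.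
   Context: Let $q$ be a power of a prime $p$. For an integer $n\geqslant 2$, $M(0,n,q)=(m_{a,b})_{1\leqslant a,b\leqslant n}$ is the $n\times n$ matrix over $\mathbb{F}_p$ with entries (binomial coefficients reduced modulo $p$, with $\binom{x}{y}=0$ for integers $0\leqslant x<y$) $$m_{a,b}=-\left[\binom{(n-a)(q-1)}{(n-b)(q-1)}-\binom{(n-a)(q-1)}{(b-1)(q-1)}\right]\ \text{ if } a\neq b,\qquad m_{a,a}=\binom{(n-a)(q-1)}{(a-1)(q-1)}.$$ (It is the matrix of coefficients, with the powers of $t$ removed, of the Atkin operator $U_t$ acting on a block of $\Gamma_0(t)$-invariant Drinfeld cusp forms of weight $k=2+(n-1)(q-1)$.) -}

module Defs where

open import Algebra.Bundles using (CommutativeRing)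
open import Data.Fin.Base using (Fin; toℕ)
open import Data.Integer.Base as ℤ using (ℤ; +_; 0ℤ; 1ℤ)
open import Data.Integer.Divisibility.Signed
  using (_∣_; divides; ∣m∣n⇒∣m+n; ∣m⇒∣-m; ∣n⇒∣m*n; ∣m⇒∣m*n)
import Data.Integer.Properties as ℤ
open import Data.Integer.Tactic.RingSolver using (solve-∀)
open import Data.Nat.Base as ℕ using (ℕ; suc; _∸_; _^_; _≤_)
open import Data.Nat.Combinatorics.Base using (_C_)
import Data.Nat.Properties as ℕ
open import Data.Product.Base using (_,_; _×_; ∃-syntax)
open import Level using (0ℓ)
open import Relation.Binary.PropositionalEquality
  using (_≡_; refl; subst)
open import Relation.Nullary.Decidable.Core using (yes; no)

_IsPowerOf_ : ℕ → ℕ → Set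
q IsPowerOf p = ∃[ r ] (1 ≤ r × q ≡ p ^ r)

-- A record rather than a synonym, so that x and y can be inferred from
-- the type of a proof.

record Congruent (p : ℕ) (x y : ℤ) : Set where
  constructor congruent
  field
    p∣x-y : + p ∣ x ℤ.- y

module _ {p : ℕ} where

  private
    infix 4 _≈_
    _≈_ : ℤ → ℤ → Set
    _≈_ = Congruent p

  ≡⇒≈ : ∀ {x y} → x ≡ y → x ≈ y
  ≡⇒≈ {x} refl = congruent (divides 0ℤ (ℤ.+-inverseʳ x))

  ≈-sym : ∀ {x y} → x ≈ y → y ≈ x
  ≈-sym {x} {y} (congruent d) =
    congruent (subst (+ p ∣_) (identity x y) (∣m⇒∣-m d))
    where
    identity : ∀ x y → ℤ.- (x ℤ.- y) ≡ y ℤ.- x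
    identity = solve-∀

  ≈-trans : ∀ {x y z} → x ≈ y → y ≈ z → x ≈ z
  ≈-trans {x} {y} {z} (congruent d) (congruent e) =
    congruent (subst (+ p ∣_) (identity x y z) (∣m∣n⇒∣m+n d e))
    where
    identity : ∀ x y z → (x ℤ.- y) ℤ.+ (y ℤ.- z) ≡ x ℤ.- z
    identity = solve-∀

  +-cong : ∀ {x y u v} → x ≈ y → u ≈ v → x ℤ.+ u ≈ y ℤ.+ v
  +-cong {x} {y} {u} {v} (congruent d) (congruent e) =
    congruent (subst (+ p ∣_) (identity x y u v) (∣m∣n⇒∣m+n d e))
    where
    identity : ∀ x y u v →
      (x ℤ.- y) ℤ.+ (u ℤ.- v) ≡ (x ℤ.+ u) ℤ.- (y ℤ.+ v)
    identity = solve-∀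

  *-cong : ∀ {x y u v} → x ≈ y → u ≈ v → x ℤ.* u ≈ y ℤ.* v
  *-cong {x} {y} {u} {v} (congruent d) (congruent e) =
    congruent (subst (+ p ∣_) (identity x y u v)
      (∣m∣n⇒∣m+n (∣m⇒∣m*n u d) (∣n⇒∣m*n y e)))
    where
    identity : ∀ x y u v →
      (x ℤ.- y) ℤ.* u ℤ.+ y ℤ.* (u ℤ.- v) ≡ x ℤ.* u ℤ.- y ℤ.* v
    identity = solve-∀

  neg-cong : ∀ {x y} → x ≈ y → ℤ.- x ≈ ℤ.- y
  neg-cong {x} {y} (congruent d) =
    congruent (subst (+ p ∣_) (identity x y) (∣m⇒∣-m d))
    where
    identity : ∀ x y → ℤ.- (x ℤ.- y) ≡ ℤ.- x ℤ.- (ℤ.- y)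
    identity = solve-∀

-- ℤ / pℤ as a setoid: integers under congruence modulo p.  For p prime
-- this is the field with p elements.

𝔽 : ℕ → CommutativeRing 0ℓ 0ℓ
𝔽 p = record
  { Carrier = ℤ
  ; _≈_ = Congruent p
  ; _+_ = ℤ._+_
  ; _*_ = ℤ._*_
  ; -_  = ℤ.-_
  ; 0#  = 0ℤ
  ; 1#  = 1ℤ
  ; isCommutativeRing = record
    { isRing = record
      { +-isAbelianGroup = record
        { isGroup = record
          { isMonoid = record
            { isSemigroup = record
              { isMagma = record
                { isEquivalence = record
                  { refl  = ≡⇒≈ refl
                  ; sym   = ≈-sym
                  ; trans = ≈-trans
                  }
                ; ∙-cong = +-cong
                }
              ; assoc = λ x y z → ≡⇒≈ (ℤ.+-assoc x y z)
              }
            ; identity = (λ x → ≡⇒≈ (ℤ.+-identityˡ x))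
                       , (λ x → ≡⇒≈ (ℤ.+-identityʳ x))
            }
          ; inverse = (λ x → ≡⇒≈ (ℤ.+-inverseˡ x))
                    , (λ x → ≡⇒≈ (ℤ.+-inverseʳ x))
          ; ⁻¹-cong = neg-cong
          }
        ; comm = λ x y → ≡⇒≈ (ℤ.+-comm x y)
        }
      ; *-cong = *-cong
      ; *-assoc = λ x y z → ≡⇒≈ (ℤ.*-assoc x y z)
      ; *-identity = (λ x → ≡⇒≈ (ℤ.*-identityˡ x))
                   , (λ x → ≡⇒≈ (ℤ.*-identityʳ x))
      ; distrib = (λ x y z → ≡⇒≈ (ℤ.*-distribˡ-+ x y z))
                , (λ x y z → ≡⇒≈ (ℤ.*-distribʳ-+ x y z))
      }
    ; *-comm = λ x y → ≡⇒≈ (ℤ.*-comm x y)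
    }
  }

module 𝔽 (p : ℕ) = CommutativeRing (𝔽 p)

reduce : (p : ℕ) → ℕ → 𝔽.Carrier p
reduce p x = + x

-- Rows and columns are numbered from 1.  The truncated subtractions below
-- are exact on indices 1 ≤ a , b ≤ n and for q ≥ 1.

index : ∀ {n} → Fin n → ℕ
index i = suc (toℕ i)

entry : (p n q a b : ℕ) → 𝔽.Carrier p
entry p n q a b with a ℕ.≟ b
... | yes _ = reduce p (((n ∸ a) ℕ.* (q ∸ 1)) C ((a ∸ 1) ℕ.* (q ∸ 1)))
... | no  _ = - (reduce p (((n ∸ a) ℕ.* (q ∸ 1)) C ((n ∸ b) ℕ.* (q ∸ 1)))
               - reduce p (((n ∸ a) ℕ.* (q ∸ 1)) C ((b ∸ 1) ℕ.* (q ∸ 1))))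
  where open 𝔽 p using (-_; _-_)

-- M(0,n,q) over 𝔽 p.

M₀ : (p n q : ℕ) → Fin n → Fin n → 𝔽.Carrier p
M₀ p n q i j = entry p n q (index i) (index j)

-- Write N = q − 1.  For 1 ≤ x , y ≤ q the base-q digits of xN and yN are
-- (x − 1 , q − x) and (y − 1 , q − y), and in the style of Lucas' theorem
-- (xN choose yN) vanishes modulo p unless x = y.  Only the last digits are
-- needed: n ∣ k (n choose k) shows that q ∤ l implies p ∣ (jq choose l), and
-- Pascal's rule extends this to p ∣ (jq + s choose iq + t) for s < t < q.
-- Since n − a ≤ q for a ≥ 2, this evaluates every row but the first, and
-- the first row vanishes beyond its first entry by the symmetry of the
-- binomial coefficients.

module Submission where

open import Defs
open import Data.Fin.Base using (Fin; toℕ) renaming (zero to fzero)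
open import Data.Fin.Properties using (toℕ<n)
open import Data.Integer.Base as ℤ using (ℤ; 0ℤ; 1ℤ)
open import Data.Integer.Divisibility.Signed using (∣ᵤ⇒∣)
import Data.Integer.Properties as ℤ
open import Data.Nat.Base
  using (ℕ; zero; suc; _+_; _*_; _∸_; _^_; _≤_; _<_; ⌈_/2⌉; NonZero;
        >-nonZero; nonTrivial⇒n>1; s≤s; s≤s⁻¹; z<s; s<s)
open import Data.Nat.Combinatorics
  using (_C_; nC1≡n; nCn≡1; nCk≡nC[n∸k]; k>n⇒nCk≡0; nCk+nC[k+1]≡[n+1]C[k+1])
open import Data.Nat.Divisibility
  using (_∣_; divides; _∣0; 1∣_; m∣m*n; n∣m*n; ∣-trans; ∣-reflexive;
        ∣m∣n⇒∣m+n; ∣m+n∣m⇒∣n; *-cancelˡ-∣; *-monoʳ-∣; >⇒∤)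
open import Data.Nat.Primality
  using (Prime; euclidsLemma; prime⇒nonZero; prime⇒nonTrivial)
open import Data.Nat.Properties
open import Data.Nat.Tactic.RingSolver using (solve-∀)
open import Data.Product.Base using (_×_; _,_)
open import Data.Sum.Base as Sum using (_⊎_; inj₁; inj₂)
open import Relation.Binary.Definitions using (tri<; tri≈; tri>)
open import Relation.Binary.PropositionalEquality
  using (_≡_; _≢_; refl; sym; trans; cong; cong₂; subst; subst₂;
        module ≡-Reasoning)
open import Relation.Nullary using (¬_; Dec; yes; no; contradiction)

-- The absorption identity, by induction on `n`. Pascal's rule splits the left side into `u` and
-- `v`; setting one `u` aside leaves the coefficients of the two induction hypotheses, and Pascal's
-- rule reassembles their sum into `u`.
[k+1]*[n+1]C[k+1]≡[n+1]*nCk : ∀ n k → suc k * (suc n C suc k) ≡ suc n * (n C k)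
[k+1]*[n+1]C[k+1]≡[n+1]*nCk zero    zero    = refl
[k+1]*[n+1]C[k+1]≡[n+1]*nCk zero    (suc k) = begin
  suc (suc k) * (1 C suc (suc k)) ≡⟨ cong (suc (suc k) *_) (k>n⇒nCk≡0 (s<s (z<s {k}))) ⟩
  suc (suc k) * 0                 ≡⟨ *-zeroʳ (suc (suc k)) ⟩
  0                               ≡⟨ cong (1 *_) (k>n⇒nCk≡0 (z<s {k})) ⟨
  1 * (0 C suc k)                 ∎
  where open ≡-Reasoning
[k+1]*[n+1]C[k+1]≡[n+1]*nCk (suc n) zero    =
  trans (*-identityˡ _) (trans (nC1≡n (suc (suc n))) (sym (*-identityʳ _)))
[k+1]*[n+1]C[k+1]≡[n+1]*nCk (suc n) (suc k) = begin
  suc (suc k) * (suc (suc n) C suc (suc k))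
    ≡⟨ cong (suc (suc k) *_) (nCk+nC[k+1]≡[n+1]C[k+1] (suc n) (suc k)) ⟨
  suc (suc k) * (u + v)
    ≡⟨ split k u v ⟩
  u + (suc k * u + suc (suc k) * v)
    ≡⟨ cong (u +_) (cong₂ _+_ ([k+1]*[n+1]C[k+1]≡[n+1]*nCk n k)
                              ([k+1]*[n+1]C[k+1]≡[n+1]*nCk n (suc k))) ⟩
  u + (suc n * (n C k) + suc n * (n C suc k))
    ≡⟨ cong (u +_) (*-distribˡ-+ (suc n) (n C k) (n C suc k)) ⟨
  u + suc n * (n C k + n C suc k)
    ≡⟨ cong (λ z → u + suc n * z) (nCk+nC[k+1]≡[n+1]C[k+1] n k) ⟩
  u + suc n * u
    ∎
  where
  open ≡-Reasoning
  u v : ℕ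
  u = suc n C suc k
  v = suc n C suc (suc k)
  split : ∀ k u v → suc (suc k) * (u + v) ≡ u + (suc k * u + suc (suc k) * v)
  split = solve-∀

n∣k*nCk : ∀ n k → n ∣ k * (n C k)
n∣k*nCk n       zero    = n ∣0
n∣k*nCk zero    (suc k) = ∣-reflexive (sym
  (trans (cong (suc k *_) (k>n⇒nCk≡0 (z<s {k}))) (*-zeroʳ (suc k))))
n∣k*nCk (suc n) (suc k) =
  subst (suc n ∣_) (sym ([k+1]*[n+1]C[k+1]≡[n+1]*nCk n k)) (m∣m*n (n C k))

-- Euclid's lemma applied `r` times: as long as `p` does not divide `n`, it divides `m`, and one
-- factor `p` is cancelled from both sides before recursing.
p^r∣m*n⇒p^r∣m⊎p∣n : ∀ {p} → Prime p → ∀ r m n → p ^ r ∣ m * n → p ^ r ∣ m ⊎ p ∣ n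
p^r∣m*n⇒p^r∣m⊎p∣n         pr zero    m n _ = inj₁ (1∣ m)
p^r∣m*n⇒p^r∣m⊎p∣n {p} pr (suc r) m n d
  with euclidsLemma m n pr (∣-trans (m∣m*n (p ^ r)) d)
... | inj₂ p∣n = inj₂ p∣n
... | inj₁ (divides k refl) =
  Sum.map₁ (λ e → subst (p * p ^ r ∣_) (*-comm p k) (*-monoʳ-∣ p e))
    (p^r∣m*n⇒p^r∣m⊎p∣n pr r k n (*-cancelˡ-∣ p (subst (p * p ^ r ∣_) (assoc k p n) d)))
  where
  instance _ = prime⇒nonZero pr
  assoc : ∀ k p n → k * p * n ≡ p * (k * n)
  assoc = solve-∀

isPowerOf⇒1< : ∀ {p q} → Prime p → q IsPowerOf p → 1 < q
isPowerOf⇒1< {p} pr (suc r , _ , refl) = <-≤-trans (nonTrivial⇒n>1 p) (m≤m*n p (p ^ r))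
  where instance
    _ = prime⇒nonTrivial pr
    _ = prime⇒nonZero pr
    _ = m^n≢0 p r

q∤l⇒p∣[jq]Cl : ∀ {p q} → Prime p → q IsPowerOf p → ∀ j l → ¬ q ∣ l → p ∣ (j * q) C l
q∤l⇒p∣[jq]Cl {p} pr (r , _ , refl) j l q∤l
  with p^r∣m*n⇒p^r∣m⊎p∣n pr r l _ (∣-trans (n∣m*n j) (n∣k*nCk (j * p ^ r) l))
... | inj₁ q∣l = contradiction q∣l q∤l
... | inj₂ p∣C = p∣C

module _ {p q : ℕ} (pr : Prime p) (pow : q IsPowerOf p) where

  -- Induction on `s`. Pascal's rule lowers the upper last digit to `s` and leaves lower last digits
  -- `t` and `suc t`, both still greater than `s` and less than `q`.
  p∣[jq+s]C[iq+t] : ∀ i j {s t} → s < t → t < q → p ∣ (j * q + s) C (i * q + t)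
  p∣[jq+s]C[iq+t] i j {zero} {t@(suc _)} s<t t<q
    rewrite +-identityʳ (j * q) =
    -- If `q` divided `i * q + t`, it would divide `t`, yet `0 < t < q`.
    q∤l⇒p∣[jq]Cl pr pow j (i * q + t) (λ d → >⇒∤ t<q (∣m+n∣m⇒∣n d (n∣m*n i)))
  p∣[jq+s]C[iq+t] i j {suc s} {suc t} (s≤s s<t) t<q
    rewrite +-suc (j * q) s | +-suc (i * q) t =
    subst (p ∣_) (nCk+nC[k+1]≡[n+1]C[k+1] (j * q + s) (i * q + t))
      (∣m∣n⇒∣m+n (p∣[jq+s]C[iq+t] i j s<t (<-trans (n<1+n t) t<q))
        (subst (λ l → p ∣ (j * q + s) C l) (+-suc (i * q) t)
          (p∣[jq+s]C[iq+t] i j (m<n⇒m<1+n s<t) t<q)))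

  private
    1<q : 1 < q
    1<q = isPowerOf⇒1< pr pow

    N : ℕ
    N = q ∸ 1

    instance
      N≢0 : NonZero N
      N≢0 = >-nonZero (m<n⇒0<n∸m 1<q)

  x<y⇒[xN]C[yN]≡0 : ∀ {x y} → x < y → (x * N) C (y * N) ≡ 0
  x<y⇒[xN]C[yN]≡0 x<y = k>n⇒nCk≡0 (*-monoˡ-< N x<y)

  -- Adding `suc x` to both sides turns each into `suc x * q`, which removes the truncated
  -- subtractions.
  base-q-digits : ∀ x → suc x ≤ q → suc x * N ≡ x * q + (q ∸ suc x)
  base-q-digits x x<q = +-cancelʳ-≡ (suc x) _ _ (begin
    suc x * N + suc x             ≡⟨ +-comm (suc x * N) (suc x) ⟩
    suc x + suc x * N             ≡⟨ *-suc (suc x) N ⟨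
    suc x * suc N                 ≡⟨ cong (suc x *_) (m+[n∸m]≡n (<⇒≤ 1<q)) ⟩
    q + x * q                     ≡⟨ +-comm q (x * q) ⟩
    x * q + q                     ≡⟨ cong (x * q +_) (m∸n+n≡m x<q) ⟨
    x * q + (q ∸ suc x + suc x)   ≡⟨ +-assoc (x * q) _ _ ⟨
    x * q + (q ∸ suc x) + suc x   ∎)
    where open ≡-Reasoning

  -- For `x < y` the binomial coefficient is already zero. For `x > y` the last digits are in the
  -- opposite order, `q ∸ x < q ∸ y`. The bound `1 ≤ y` excludes the value 1 at `y = 0` and keeps
  -- `q ∸ y` below `q`.
  p∣[xN]C[yN] : ∀ {x y} → x ≤ q → 1 ≤ y → x ≢ y → p ∣ (x * N) C (y * N)
  p∣[xN]C[yN] {x} {y} x≤q 1≤y x≢y with <-cmp x y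
  ... | tri< x<y _ _ = subst (p ∣_) (sym (x<y⇒[xN]C[yN]≡0 x<y)) (p ∣0)
  ... | tri≈ _ x≡y _ = contradiction x≡y x≢y
  p∣[xN]C[yN] {suc x} {suc y} x≤q _ _ | tri> _ _ y<x =
    subst₂ (λ k l → p ∣ k C l) (sym (base-q-digits x x≤q)) (sym (base-q-digits y y≤q))
      (p∣[jq+s]C[iq+t] y x (∸-monoʳ-< y<x x≤q) (∸-monoʳ-< z<s y≤q))
    where y≤q = ≤-trans (<⇒≤ y<x) x≤q

  open 𝔽 p using (_≈_; 0#; 1#; -_; _-_)

  ∣⇒≈0 : ∀ {m} → p ∣ m → reduce p m ≈ 0#
  ∣⇒≈0 {m} d = congruent (∣ᵤ⇒∣ (subst (p ∣_) (sym (+-identityʳ m)) d))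

  binom : ℕ → ℕ → ℤ
  binom x y = reduce p ((x * N) C (y * N))

  binom-diagonal : ∀ {x y} → x ≡ y → binom x y ≈ 1#
  binom-diagonal {x} refl = ≡⇒≈ (cong (reduce p) (nCn≡1 (x * N)))

  binom-< : ∀ {x y} → x < y → binom x y ≈ 0#
  binom-< x<y = ≡⇒≈ (cong (reduce p) (x<y⇒[xN]C[yN]≡0 x<y))

  binom-offDiagonal : ∀ {x y} → x ≤ q → 1 ≤ y → x ≢ y → binom x y ≈ 0#
  binom-offDiagonal x≤q 1≤y x≢y = ∣⇒≈0 (p∣[xN]C[yN] x≤q 1≤y x≢y)

  binom-sym : ∀ {x y} → y ≤ x → binom x y ≡ binom x (x ∸ y)
  binom-sym {x} {y} y≤x = cong (reduce p)
    (trans (nCk≡nC[n∸k] (*-monoˡ-≤ N y≤x))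
           (cong ((x * N) C_) (sym (*-distribʳ-∸ N x y))))

  module _ {n : ℕ} where

    -- This lemma and the next settle the test `a ≟ b` inside `entry`, so that later arguments only
    -- evaluate `binom`.
    entry-diagonal : ∀ a {u} → binom (n ∸ a) (a ∸ 1) ≈ u → entry p n q a a ≈ u
    entry-diagonal a h with a ≟ a
    ... | yes _  = h
    ... | no a≢a = contradiction refl a≢a

    entry-offDiagonal : ∀ a b {u v} → a ≢ b →
      binom (n ∸ a) (n ∸ b) ≈ u → binom (n ∸ a) (b ∸ 1) ≈ v → entry p n q a b ≈ - (u - v)
    entry-offDiagonal a b a≢b h k with a ≟ b
    ... | yes a≡b = contradiction a≡b a≢b
    ... | no _    = neg-cong (+-cong h (neg-cong k))

    -- In row 1 the lower indices `n ∸ suc b` and `b` add up to the upper index `n ∸ 1`, so the two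
    -- terms are equal and cancel exactly, already over the integers.
    entry-firstRow : ∀ b → b ≢ 0 → suc b ≤ n → entry p n q 1 (suc b) ≈ 0#
    entry-firstRow b b≢0 (s≤s b≤n) = ≈-trans
      (entry-offDiagonal 1 (suc b) (λ 1≡b → b≢0 (sym (suc-injective 1≡b)))
        (≡⇒≈ (sym (binom-sym b≤n))) (≡⇒≈ refl))
      (neg-cong (≡⇒≈ (ℤ.+-inverseʳ (binom (n ∸ 1) b))))

    entry-firstColumn : ∀ a → suc a ≤ n → entry p n q (suc a) 1 ≈ 1#
    entry-firstColumn zero      _   = entry-diagonal 1 (≡⇒≈ refl)
    entry-firstColumn a@(suc _) a<n =
      -- The value `- (0# - 1#)` computes to `1#`.
      entry-offDiagonal (suc a) 1 (λ ()) (binom-< (∸-monoʳ-< (s<s z<s) a<n)) (≡⇒≈ refl)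

    entry-lastCorner : 2 ≤ n → entry p n q n n ≈ 0#
    entry-lastCorner 1<n = entry-diagonal n
      (subst (λ x → binom x (n ∸ 1) ≈ 0#) (sym (n∸n≡0 n)) (binom-< (m<n⇒0<n∸m 1<n)))

    -- The first term has lower index 0, hence value 1; the second has lower index `n ∸ 1`, which
    -- exceeds `n ∸ a`.
    entry-lastColumn : ∀ {a} → 2 ≤ a → a < n → entry p n q a n ≈ - 1#
    entry-lastColumn {a} 1<a a<n = entry-offDiagonal a n (<⇒≢ a<n)
      (subst (λ y → binom (n ∸ a) y ≈ 1#) (sym (n∸n≡0 n)) (≡⇒≈ refl))
      (binom-< (∸-monoʳ-< 1<a (<⇒≤ a<n)))

    module _ (n≤q+2 : n ≤ q + 2) {a b : ℕ} (a≤n : a ≤ n) (b+1<n : suc b < n) where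

      private
        -- This is where `n ≤ q + 2` enters: it brings every row but the first into the range of
        -- `binom-offDiagonal`.
        n∸a≤q : 2 ≤ a → n ∸ a ≤ q
        n∸a≤q 2≤a = ≤-trans (∸-monoʳ-≤ n 2≤a)
          (m≤n+o⇒m∸n≤o n 2 (subst (n ≤_) (+-comm q 2) n≤q+2))

        binom-firstTerm : 2 ≤ a → a ≢ suc b → binom (n ∸ a) (n ∸ suc b) ≈ 0#
        binom-firstTerm 2≤a a≢b = binom-offDiagonal (n∸a≤q 2≤a) (m<n⇒0<n∸m b+1<n)
          (λ eq → a≢b (∸-cancelˡ-≡ a≤n (<⇒≤ b+1<n) eq))

        sum-identity : ∀ a b → a + suc b ≡ b + a + 1
        sum-identity = solve-∀

      entry-antidiagonal : a + suc b ≡ n + 1 → entry p n q a (suc b) ≈ 1#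
      entry-antidiagonal a+b≡n+1 = helper (a ≟ suc b)
        where
        n≡b+a : n ≡ b + a
        n≡b+a = sym (+-cancelʳ-≡ 1 _ _ (trans (sym (sum-identity a b)) a+b≡n+1))

        n∸a≡b : n ∸ a ≡ b
        n∸a≡b = trans (cong (_∸ a) n≡b+a) (m+n∸n≡m b a)

        -- The antidiagonal meets row 1 only in column `n`, which `suc b < n` rules out.
        2≤a : 2 ≤ a
        2≤a = +-cancelˡ-< b 1 a (subst₂ _<_ (+-comm 1 b) n≡b+a b+1<n)

        helper : Dec (a ≡ suc b) → entry p n q a (suc b) ≈ 1#
        helper (yes refl) = entry-diagonal a (binom-diagonal n∸a≡b)
        helper (no a≢b)   =
          entry-offDiagonal a (suc b) a≢b (binom-firstTerm 2≤a a≢b) (binom-diagonal n∸a≡b)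

      -- From row 2 on, the second binomial survives only if `n ∸ a ≡ b`, that is, on the
      -- antidiagonal, and the first only if `a ≡ suc b`, where `entry` uses the second alone. In
      -- row 1, `n ∸ 1` may be `q + 1`, so symmetry takes over.
      entry-offAntidiagonal : 1 ≤ a → 1 ≤ b → a + suc b ≢ n + 1 → entry p n q a (suc b) ≈ 0#
      entry-offAntidiagonal 1≤a 1≤b a+b≢n+1 = helper (m≤n⇒m<n∨m≡n 1≤a) (a ≟ suc b)
        where
        binom-secondTerm : 2 ≤ a → binom (n ∸ a) b ≈ 0#
        binom-secondTerm 2≤a = binom-offDiagonal (n∸a≤q 2≤a) 1≤b λ n∸a≡b → a+b≢n+1
          (trans (sum-identity a b)
            (cong (_+ 1) (trans (cong (_+ a) (sym n∸a≡b)) (m∸n+n≡m a≤n))))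

        helper : 1 < a ⊎ 1 ≡ a → Dec (a ≡ suc b) → entry p n q a (suc b) ≈ 0#
        helper (inj₂ refl) _          = entry-firstRow b (m<n⇒n≢0 1≤b) (<⇒≤ b+1<n)
        helper (inj₁ 2≤a)  (yes refl) = entry-diagonal a (binom-secondTerm 2≤a)
        helper (inj₁ 2≤a)  (no a≢b)   =
          entry-offDiagonal a (suc b) a≢b (binom-firstTerm 2≤a a≢b) (binom-secondTerm 2≤a)

theorem5p6 :
  ∀ (p q n : ℕ) → Prime p → q IsPowerOf p → 2 ≤ n → n ≤ q + 2 →
  let open 𝔽 p using (_≈_)
      open 𝔽 p using (0#)
      open 𝔽 p using (1#)
      open 𝔽 p using (-_)
      m = M₀ p n q
  in
    (∀ (a b : Fin n) → index b ≡ 1 → m a b ≈ 1#)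
  × (∀ (a b : Fin n) → index a ≤ n ∸ 2 → 2 ≤ index b → index b ≤ ⌈ n /2⌉ →
       index b < n + 1 ∸ index a → m a b ≈ 0#)
  × (∀ (a b : Fin n) → index a ≡ 1 → index b ≡ n → m a b ≈ 0#)
  × (∀ (a b : Fin n) → index a ≡ n → index b ≡ n → m a b ≈ 0#)
  × (∀ (a b : Fin n) → 2 ≤ index a → index a ≤ n ∸ 1 → index b ≡ n → m a b ≈ (- 1#))
  × (∀ (a b : Fin n) → 2 ≤ index b → index b ≤ n ∸ 1 →
       (index a + index b ≡ n + 1 → m a b ≈ 1#)
     × (index a + index b ≢ n + 1 → m a b ≈ 0#))
theorem5p6 p q n@(suc (suc k)) pr pow 2≤n@(s≤s (s≤s _)) n≤q+2 =
    (λ { a fzero refl → entry-firstColumn pr pow (toℕ a) (toℕ<n a) })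
  , (λ a b _ 2≤b b≤⌈n/2⌉ b<n+1∸a →
       entry-offAntidiagonal pr pow n≤q+2 (toℕ<n a)
         (≤-<-trans b≤⌈n/2⌉ (⌈n/2⌉<n k)) z<s (s≤s⁻¹ 2≤b)
         (λ a+b≡n+1 → <⇒≢ b<n+1∸a
           (trans (sym (m+n∸m≡n (index a) (index b))) (cong (_∸ index a) a+b≡n+1))))
  , (λ { fzero b refl b≡n →
       entry-firstRow pr pow (toℕ b) (λ b≡0 → contradiction (trans (sym b≡n) (cong suc b≡0)) λ ())
         (toℕ<n b) })
  , (λ a b a≡n b≡n →
       subst₂ (λ x y → Congruent p (entry p n q x y) 0ℤ) (sym a≡n) (sym b≡n)
         (entry-lastCorner pr pow 2≤n))
  , (λ a b 2≤a a≤n∸1 b≡n →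
       subst (λ y → Congruent p (entry p n q (index a) y) (ℤ.- 1ℤ)) (sym b≡n)
         (entry-lastColumn pr pow 2≤a (s≤s a≤n∸1)))
  , (λ a b 2≤b b≤n∸1 →
       entry-antidiagonal pr pow n≤q+2 (toℕ<n a) (s≤s b≤n∸1)
     , entry-offAntidiagonal pr pow n≤q+2 (toℕ<n a) (s≤s b≤n∸1) z<s (s≤s⁻¹ 2≤b))
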